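{- Let $\mathcal G=\{G_1,\dots,G_\ell\}$ be a finite family of pairwise homomorphically incomparable oriented graphs, each of which is a core, such that: (a) for every $G\in\mathcal G$, there is no homomorphism $\prod_{H\in\mathcal G,\,H\neq G}H\to G$, and there is a homomorphism $\prod_{H\in\mathcal G,\,H\ne G}H\to G^{\triangleleft}$; (b) $\mathcal G$ is an orthogonal family, i.e. for every $G\in\mathcal G$, every homomorphism $\prod_{H\in\mathcal G}H\to G$ is surjective on vertices. Then $\prod_{G\in\mathcal G}G^{\triangleleft}$ is a core.
   Context: All digraphs are finite, without loops and without parallel arcs; a pair of opposite arcs (a digon) is allowed in a digraph. An oriented graph is a digraph with no digon. A homomorphism $G\to H$ is a map $V(G)\to V(H)$ sending arcs to arcs (preserving direction). Two digraphs are incomparable if there is no homomorphism from either one to the other. All products are tensor products: the vertex set is the Cartesian product, and there is an arc from $(u_i)_i$ to $(v_i)_i$ iff $u_i\to v_i$ is an arc in every coordinate $i$. A digraph is a core if its only retract (endomorphism $\phi$ with $\phi^2=\phi$) is the identity (equivalently, it is not homomorphically equivalent to any digraph with fewer vertices). The cone $G^{\triangleleft}$ of a digraph $G$ is obtained from $G$ by adding one new vertex (the apex), joined by arcs in both directions to every vertex of $G$. -}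

module Defs where

open import Data.Fin.Base using (Fin; zero; suc)
open import Data.Fin.Properties using (*↔×; 1↔⊤)
open import Data.List.Base using (List; foldr)
open import Data.Maybe.Base using (Maybe; just; nothing)
open import Data.Nat.Base using (ℕ; suc; _*_)
open import Data.Product.Base using (_×_; _,_)
open import Data.Product.Function.NonDependent.Propositional using (_×-↔_)
open import Data.Unit.Base using (⊤; tt)
open import Function.Bundles using (_↔_; mk↔ₛ′; Inverse)
open import Function.Construct.Composition using (_↔-∘_)
open import Function.Construct.Symmetry using (↔-sym)
open import Level using (0ℓ)
open import Relation.Binary.Core using (Rel)
open import Relation.Binary.Definitions using (Asymmetric; Decidable; Irreflexive)
open import Relation.Binary.Morphism.Structures using (IsRelHomomorphism)
open import Relation.Binary.PropositionalEquality.Core using (_≡_; refl; cong)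
open import Relation.Nullary using (¬_; yes; no)
open import Relation.Nullary.Decidable using (_×-dec_)

-- Finite digraphs.  Only the existence of an arc matters, so there are no
-- parallel arcs.  Loops are allowed here because the empty tensor product is
-- a single vertex with a loop; oriented graphs are loopless by definition,
-- and cones and nonempty products of loopless digraphs are again loopless.
record Digraph : Set₁ where
  infix 4 _⟶_ _⟶?_
  field
    V      : Set
    _⟶_   : Rel V 0ℓ
    _⟶?_  : Decidable _⟶_
    size   : ℕ
    finite : V ↔ Fin size

open Digraph public using (V)

record IsOriented (G : Digraph) : Set where
  open Digraph G using (_⟶_)
  field
    loopless : Irreflexive _≡_ _⟶_
    noDigon  : Asymmetric _⟶_

record Hom (G H : Digraph) : Set where
  field
    map               : V G → V H
    isRelHomomorphism : IsRelHomomorphism (Digraph._⟶_ G) (Digraph._⟶_ H) map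

open Hom public using (map)

Incomparable : Rel Digraph 0ℓ
Incomparable G H = ¬ Hom G H × ¬ Hom H G

IsCore : Digraph → Set
IsCore G = (φ : Hom G G) →
           (∀ x → map φ (map φ x) ≡ map φ x) →
           ∀ x → map φ x ≡ x

infixr 7 _⊗_

_⊗_ : Digraph → Digraph → Digraph
G ⊗ H = record
  { V      = V G × V H
  ; _⟶_   = λ { (u , x) (v , y) → (u G.⟶ v) × (x H.⟶ y) }
  ; _⟶?_  = λ { (u , x) (v , y) → (u G.⟶? v) ×-dec (x H.⟶? y) }
  ; size   = G.size * H.size
  ; finite = ↔-sym *↔× ↔-∘ (G.finite ×-↔ H.finite)
  }
  where
  module G = Digraph G
  module H = Digraph H

loop : Digraph
loop = record
  { V      = ⊤
  ; _⟶_   = λ _ _ → ⊤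
  ; _⟶?_  = λ _ _ → yes tt
  ; size   = 1
  ; finite = ↔-sym 1↔⊤
  }

∏ : List Digraph → Digraph
∏ = foldr _⊗_ loop

-- `nothing` is the apex.
data ConeArc (G : Digraph) : Rel (Maybe (V G)) 0ℓ where
  base     : ∀ {u v} → Digraph._⟶_ G u v → ConeArc G (just u) (just v)
  fromApex : ∀ {v} → ConeArc G nothing (just v)
  toApex   : ∀ {u} → ConeArc G (just u) nothing

coneArc? : ∀ G → Decidable (ConeArc G)
coneArc? G nothing  nothing  = no λ ()
coneArc? G nothing  (just _) = yes fromApex
coneArc? G (just _) nothing  = yes toApex
coneArc? G (just u) (just v) with Digraph._⟶?_ G u v
... | yes a = yes (base a)
... | no ¬a = no λ { (base a) → ¬a a }

Maybe-finite : ∀ {A : Set} {n} → A ↔ Fin n → Maybe A ↔ Fin (suc n)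
Maybe-finite {A} {n} A↔n = mk↔ₛ′ f g f∘g g∘f
  where
  open Inverse A↔n

  f : Maybe A → Fin (suc n)
  f nothing  = zero
  f (just x) = suc (to x)

  g : Fin (suc n) → Maybe A
  g zero    = nothing
  g (suc i) = just (from i)

  f∘g : ∀ i → f (g i) ≡ i
  f∘g zero    = refl
  f∘g (suc i) = cong suc (strictlyInverseˡ i)

  g∘f : ∀ x → g (f x) ≡ x
  g∘f nothing  = refl
  g∘f (just x) = cong just (strictlyInverseʳ x)

infix 8 _◁

_◁ : Digraph → Digraph
G ◁ = record
  { V      = Maybe (V G)
  ; _⟶_   = ConeArc G
  ; _⟶?_  = coneArc? G
  ; size   = suc (Digraph.size G)
  ; finite = Maybe-finite (Digraph.finite G)
  }

{-# OPTIONS --safe #-}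

-- A digon of a cone over an oriented graph has exactly one end at the apex, so
-- a digon of P = ∏ G◁ joins two vertices whose sets of apex coordinates are
-- complementary.  Hence whether the i-th coordinate of φ x is the apex depends
-- only on the set A of apex coordinates of x, and the sets A for which it is
-- form a maximal intersecting family.  If {i} were not in that family, φ would
-- induce a homomorphism ∏_{H ≠ G_i} H × G_i◁ → G_i, and (a) forbids this.  So
-- φ preserves the set of apex coordinates.
--
-- For the other coordinates: if every out-neighbour (in-neighbour) v of u = x_i
-- is the i-th coordinate of φ y for some out-neighbour (in-neighbour) y of x, then
-- φ(x)_i dominates u in G_i, hence equals u because G_i is a core.  Orthogonality
-- and φ² = φ provide such y when all other coordinates of x are apexes; this is
-- then propagated to all other x, using that, by incomparability, every G_j has
-- a vertex that is neither a source nor a sink.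

module Submission where

open import Defs
open import Data.Bool.Base using (Bool; true; false; if_then_else_)
open import Data.Fin.Base using (Fin; zero; suc; punchIn)
open import Data.Fin.Properties using (_≟_; any?; inj⇒≟; punchInᵢ≢i)
open import Data.List.Base as List using (List; []; _∷_; length; lookup; removeAt)
open import Data.List.Membership.Propositional.Properties using (∈-lookup)
open import Data.List.Relation.Unary.All as All using (All)
open import Data.List.Relation.Unary.AllPairs using (AllPairs; _∷_)
open import Data.Maybe.Base using (Maybe; just; nothing)
open import Data.Nat.Base using (ℕ; suc)
open import Data.Product.Base using (Σ; ∃; ∃-syntax; _×_; _,_; proj₁; proj₂; swap)
open import Data.Unit.Base using (tt)
open import Function.Base using (_∘_)
open import Function.Bundles using (Inverse)
open import Function.Definitions using (Surjective)
open import Function.Properties.Inverse using (↔⇒↣)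
open import Level using (0ℓ)
open import Relation.Binary.Core using (Rel)
open import Relation.Binary.Definitions using (DecidableEquality; Symmetric)
open import Relation.Binary.Morphism.Structures using (IsRelHomomorphism)
open import Relation.Binary.PropositionalEquality.Core
  using (_≡_; _≢_; refl; sym; trans; cong; cong₂; subst; subst₂)
open import Relation.Nullary using (¬_; Dec; yes; no; contradiction)
open import Relation.Nullary.Decidable using (map′; _×-dec_)
open import Relation.Unary as U using (Pred)

open Digraph using (_⟶_; _⟶?_)

-- Homomorphisms, search over vertices, and steps in cones.

mkHom : ∀ {G H} (f : V G → V H) → (∀ {x y} → _⟶_ G x y → _⟶_ H (f x) (f y)) → Hom G H
mkHom f f-arc = record
  { map = f
  ; isRelHomomorphism = record { cong = f-arc }
  }

map-arc : ∀ {G H} (h : Hom G H) {x y} → _⟶_ G x y → _⟶_ H (map h x) (map h y)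
map-arc h = IsRelHomomorphism.cong (Hom.isRelHomomorphism h)

infixr 9 _⊙_

_⊙_ : ∀ {G H K} → Hom H K → Hom G H → Hom G K
h ⊙ k = mkHom (map h ∘ map k) (map-arc h ∘ map-arc k)

⊗-proj₁ : ∀ {G H} → Hom (G ⊗ H) G
⊗-proj₁ = mkHom proj₁ proj₁

⊗-proj₂ : ∀ {G H} → Hom (G ⊗ H) H
⊗-proj₂ = mkHom proj₂ proj₂

vertex≟ : ∀ G → DecidableEquality (V G)
vertex≟ G = inj⇒≟ (↔⇒↣ (Digraph.finite G))

anyVertex? : ∀ G {P : Pred (V G) 0ℓ} → U.Decidable P → Dec (∃ P)
anyVertex? G {P} P? = map′
  (λ (k , Pk) → from k , Pk)
  (λ (x , Px) → to x , subst P (sym (strictlyInverseʳ x)) Px)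
  (any? (P? ∘ from))
  where open Inverse (Digraph.finite G)

-- Arcs traversed forwards (false) or backwards (true), so that in- and
-- out-neighbours are treated by the same arguments.
Step : ∀ G → Bool → Rel (V G) 0ℓ
Step G false u v = _⟶_ G u v
Step G true  u v = _⟶_ G v u

map-step : ∀ {G H} (h : Hom G H) s {x y} → Step G s x y → Step H s (map h x) (map h y)
map-step h false = map-arc h
map-step h true  = map-arc h

cone-step : ∀ {G} s {u v} → Step G s u v → Step (G ◁) s (just u) (just v)
cone-step false = base
cone-step true  = base

uncone-step : ∀ {G} s {u v} → Step (G ◁) s (just u) (just v) → Step G s u v
uncone-step false (base a) = a
uncone-step true  (base a) = a

leaveApex : ∀ {G} s {v} → Step (G ◁) s nothing (just v)
leaveApex false = fromApex
leaveApex true  = toApex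

enterApex : ∀ {G} s {u} → Step (G ◁) s (just u) nothing
enterApex false = toApex
enterApex true  = fromApex

unjust : ∀ {A : Set} (m : Maybe A) → m ≢ nothing → A
unjust (just x) _ = x
unjust nothing  ≢ = contradiction refl ≢

just-unjust : ∀ {A : Set} (m : Maybe A) (m≢ : m ≢ nothing) → just (unjust m m≢) ≡ m
just-unjust (just _) _ = refl
just-unjust nothing  ≢ = contradiction refl ≢

uncone : ∀ {X G} (h : Hom X (G ◁)) → (∀ x → map h x ≢ nothing) → Hom X G
uncone {X} {G} h ≢apex = mkHom (λ x → unjust (map h x) (≢apex x))
  λ {x} {y} a → uncone-step false
    (subst₂ (ConeArc G) (sym (just-unjust _ (≢apex x))) (sym (just-unjust _ (≢apex y)))
      (map-arc h a))

-- Dominated vertices in a core.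

module _ {G : Digraph} (oriented : IsOriented G) (core : IsCore G) where
  open IsOriented oriented

  private
    module _ (u w : V G) (dominates : ∀ s {v} → Step G s u v → Step G s w v) where

      fold : V G → V G
      fold x with vertex≟ G x u
      ... | yes _ = w
      ... | no  _ = x

      fold-arc : ∀ {x y} → _⟶_ G x y → _⟶_ G (fold x) (fold y)
      fold-arc {x} {y} a with vertex≟ G x u | vertex≟ G y u
      ... | yes refl | yes refl = contradiction a (loopless refl)
      ... | yes refl | no _     = dominates false a
      ... | no _     | yes refl = dominates true a
      ... | no _     | no _     = a

      fold-w : fold w ≡ w
      fold-w with vertex≟ G w u
      ... | yes _ = refl
      ... | no  _ = refl

      fold-u : fold u ≡ w
      fold-u with vertex≟ G u u
      ... | yes _   = refl
      ... | no  u≢u = contradiction refl u≢u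

      fold-idem : ∀ x → fold (fold x) ≡ fold x
      fold-idem x with vertex≟ G x u in eq
      ... | yes _ = fold-w
      ... | no  _ rewrite eq = refl

  -- Moving `u` to `w` and fixing all other vertices is a retraction: without loops, an arc at `u`
  -- has its other end fixed. In a core it must be the identity.
  core-dominated : ∀ u w → (∀ s {v} → Step G s u v → Step G s w v) → w ≡ u
  core-dominated u w dom = trans (sym (fold-u u w dom))
    (core (mkHom (fold u w dom) (fold-arc u w dom)) (fold-idem u w dom) u)

-- Changing one coordinate of a tuple.

module _ {n : ℕ} {A : Fin n → Set} where

  update : (∀ j → A j) → (i : Fin n) → A i → ∀ j → A j
  update f i a j with j ≟ i
  ... | yes refl = a
  ... | no  _    = f j

  update-at : ∀ f i a → update f i a i ≡ a
  update-at f i a with i ≟ i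
  ... | yes refl = refl
  ... | no  i≢i  = contradiction refl i≢i

  update-elim : ∀ (P : ∀ j → A j → Set) {f i a} →
                P i a → (∀ j → j ≢ i → P j (f j)) → ∀ j → P j (update f i a j)
  update-elim P {i = i} Pa Pf j with j ≟ i
  ... | yes refl = Pa
  ... | no  j≢i  = Pf j j≢i

module _ {n : ℕ} {A B : Fin n → Set} where

  update-elim₂ : ∀ (R : ∀ j → A j → B j → Set) {f g i a b} →
                 R i a b → (∀ j → j ≢ i → R j (f j) (g j)) →
                 ∀ j → R j (update f i a j) (update g i b j)
  update-elim₂ R {i = i} Rab Rfg j with j ≟ i
  ... | yes refl = Rab
  ... | no  j≢i  = Rfg j j≢i

-- Vertices that are neither sources nor sinks.

Through : ∀ G → Pred (V G) 0ℓ
Through G c = Σ (Bool → V G) λ nb → ∀ s → Step G s c (nb s)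

module _ {G : Digraph} where

  out? : U.Decidable (λ u → ∃ λ v → _⟶_ G u v)
  out? u = anyVertex? G (_⟶?_ G u)

  -- Vertices with an out-neighbour go to `a`, the rest to `b`; the head of an arc has an
  -- in-neighbour, so it is among the rest.
  arc⇒Hom : (∀ u → ¬ ((∃ λ v → _⟶_ G v u) × (∃ λ v → _⟶_ G u v))) →
            ∀ {H a b} → _⟶_ H a b → Hom G H
  arc⇒Hom none {H} {a} {b} a⟶b = mkHom f f-arc
    where
    f : V G → V H
    f u with out? u
    ... | yes _ = a
    ... | no  _ = b

    f-arc : ∀ {u v} → _⟶_ G u v → _⟶_ H (f u) (f v)
    f-arc {u} {v} u⟶v with out? u | out? v
    ... | yes _  | no _  = a⟶b
    ... | yes _  | yes o = contradiction ((u , u⟶v) , o) (none v)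
    ... | no ¬o  | _     = contradiction (v , u⟶v) ¬o

-- An arcless `H` would map to any vertex of `G`, and an empty `G` to every digraph.
incomparable⇒arc : ∀ {G H} → Incomparable G H → ∃[ a ] ∃[ b ] _⟶_ H a b
incomparable⇒arc {G} {H} (¬G⇒H , ¬H⇒G) with anyVertex? H (out? {H})
... | yes arc = arc
... | no  ¬arc with anyVertex? G {λ u → u ≡ u} (λ _ → yes refl)
...   | yes (u , _) = contradiction
        (mkHom (λ _ → u) (λ a → contradiction (_ , _ , a) ¬arc)) ¬H⇒G
...   | no  empty   = contradiction
        (mkHom (λ u → contradiction (u , refl) empty) (λ {u} → contradiction (u , refl) empty)) ¬G⇒H

incomparable⇒through : ∀ {G H} → Incomparable G H → ∃ (Through G)
incomparable⇒through {G} {H} inc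
  with anyVertex? G (λ u → anyVertex? G (λ v → _⟶?_ G v u) ×-dec out? {G} u)
... | yes (c , (b , b⟶c) , (d , c⟶d)) =
  c , (λ s → if s then b else d) , λ { false → c⟶d ; true → b⟶c }
... | no  none with incomparable⇒arc inc
...   | _ , _ , a⟶b = contradiction (arc⇒Hom (λ u t → none (u , t)) a⟶b) (proj₁ inc)

-- Digons in cones over oriented graphs.

digon-apex : ∀ {G} → IsOriented G → ∀ {m m′} →
             (∀ s → Step (G ◁) s m m′) → m ≢ nothing → m′ ≡ nothing
digon-apex or {nothing}           _ m≢ = contradiction refl m≢
digon-apex or {just _} {nothing}  _ _  = refl
digon-apex or {just _} {just _}   d _  = contradiction (uncone-step true (d true))
  (IsOriented.noDigon or (uncone-step false (d false)))

apex-loopless : ∀ {G m m′} → ConeArc G m m′ → m ≡ nothing → m′ ≢ nothing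
apex-loopless () refl refl

-- Applied twice, this keeps the apex and replaces every base vertex by `c`.
opposite : ∀ {G} → V G → V (G ◁) → V (G ◁)
opposite c nothing  = just c
opposite c (just _) = nothing

opposite-step : ∀ {G} (c : V G) m s → Step (G ◁) s m (opposite {G} c m)
opposite-step c nothing  s = leaveApex s
opposite-step c (just _) s = enterApex s

-- Idempotent endomorphisms of a product of cones.

module ConeProduct
  {n : ℕ} (G : Fin n → Digraph)
  (oriented : ∀ i → IsOriented (G i))
  (core : ∀ i → IsCore (G i))
  (c : ∀ i → V (G i))
  (nb : ∀ i → Bool → V (G i))
  (c-nb : ∀ i s → Step (G i) s (c i) (nb i s))
  -- `X i` stands for the product of the factors other than `G i`, and `Y` for the product of all.
  (X : Fin n → Digraph)
  (X⇒G : ∀ i j → j ≢ i → Hom (X i) (G j))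
  (X⇏Gᵢ : ∀ i → ¬ Hom (X i) (G i))
  (X⇒Gᵢ◁ : ∀ i → Hom (X i) (G i ◁))
  (Y : Digraph)
  (Y⇒G : ∀ i → Hom Y (G i))
  (orthogonal : ∀ i (h : Hom Y (G i)) → Surjective _≡_ _≡_ (map h))
  where

  Point : Set
  Point = ∀ j → V (G j ◁)

  StepP : Bool → Rel Point 0ℓ
  StepP s p q = ∀ j → Step (G j ◁) s (p j) (q j)

  module _
    (Φ : Point → Point)
    (Φ-arc : ∀ {p q} → StepP false p q → StepP false (Φ p) (Φ q))
    (Φ-idem : ∀ p j → Φ (Φ p) j ≡ Φ p j)
    where

    Φ-step : ∀ s {p q} → StepP s p q → StepP s (Φ p) (Φ q)
    Φ-step false = Φ-arc
    Φ-step true  = Φ-arc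

    -- Preservation of apex coordinates.

    complement : (∀ j → V (G j)) → Point → Point
    complement v p j = opposite {G j} (v j) (p j)

    Φ-complement-apex : ∀ v p i → Φ p i ≢ nothing → Φ (complement v p) i ≡ nothing
    Φ-complement-apex v p i = digon-apex (oriented i)
      (λ s → Φ-step s (λ j → opposite-step (v j) (p j) s) i)

    Φ-complement-base : ∀ v p i → Φ p i ≡ nothing → Φ (complement v p) i ≢ nothing
    Φ-complement-base v p i = apex-loopless
      (Φ-arc (λ j → opposite-step (v j) (p j) false) i)

    module _ (i : Fin n) where

      graph : V (X i) → Point
      graph x j with j ≟ i
      ... | yes refl = map (X⇒Gᵢ◁ i) x
      ... | no  j≢i  = just (map (X⇒G i j j≢i) x)

      graph-arc : ∀ {x y} → _⟶_ (X i) x y → StepP false (graph x) (graph y)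
      graph-arc a j with j ≟ i
      ... | yes refl = map-arc (X⇒Gᵢ◁ i) a
      ... | no  j≢i  = base (map-arc (X⇒G i j j≢i) a)

      -- The double complement has the apexes of graph x but c j in every other
      -- coordinate j; unlike those of graph x, these surely have out-neighbours.
      graph⟶complement : ∀ x p → p i ≡ nothing →
        StepP false (complement c (complement c (graph x)))
                    (complement (λ j → nb j false) p)
      graph⟶complement x p pᵢ j with j ≟ i
      ... | yes refl rewrite pᵢ with map (X⇒Gᵢ◁ i) x
      ...   | nothing = fromApex
      ...   | just _  = base (c-nb i false)
      graph⟶complement x p pᵢ j | no _ with p j
      ...   | nothing = base (c-nb j false)
      ...   | just _  = toApex

      -- Otherwise coordinate `i` of `Φ` along `graph` would never be the apex, and so would give a
      -- homomorphism from `X i` to `G i`.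
      Φ-apex : ∀ p → p i ≡ nothing → Φ p i ≡ nothing
      Φ-apex p pᵢ with Φ p i in Φpᵢ
      ... | nothing = refl
      ... | just w  = contradiction
        (uncone {G = G i} (mkHom (λ x → Φ (graph x) i) (λ a → Φ-arc (graph-arc a) i)) avoids)
        (X⇏Gᵢ i)
        where
        -- If `Φ (graph x) i` were the apex, then `Φ` would have the apex at `i` both on the double
        -- complement of `graph x` and on a complement of `p`. An arc joins these two points, but
        -- the apex has no loop.
        avoids : ∀ x → Φ (graph x) i ≢ nothing
        avoids x Φgᵢ = apex-loopless
          (Φ-arc (graph⟶complement x p pᵢ) i)
          (Φ-complement-apex c _ i (Φ-complement-base c _ i Φgᵢ))
          (Φ-complement-apex _ p i (λ eq → contradiction (trans (sym Φpᵢ) eq) λ ()))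

      -- In the complement of `p`, coordinate `i` is the apex and stays so by `Φ-apex`; the two ends
      -- of a digon are not both apexes.
      Φ-base : ∀ p → p i ≢ nothing → Φ p i ≢ nothing
      Φ-base p pᵢ≢ Φpᵢ = Φ-complement-base c p i Φpᵢ (Φ-apex (complement c p) eq)
        where
        eq : complement c p i ≡ nothing
        eq = digon-apex (oriented i) (opposite-step (c i) (p i)) pᵢ≢

      -- Preservation of base coordinates.

      Φ-dominated : ∀ p {u} → p i ≡ just u →
        (∀ s {v} → Step (G i) s u v → ∃[ q ] StepP s p q × Φ q i ≡ just v) →
        Φ p i ≡ just u
      Φ-dominated p {u} pᵢ next with Φ p i in Φpᵢ
      ... | nothing = contradiction Φpᵢ (Φ-base p λ eq → contradiction (trans (sym pᵢ) eq) λ ())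
      ... | just w  = cong just (core-dominated (oriented i) (core i) u w
        λ s u⟶v → let (q , p⟶q , Φqᵢ) = next s u⟶v in
          uncone-step s (subst₂ (Step (G i ◁) s) Φpᵢ Φqᵢ (Φ-step s p⟶q i)))

    -- By orthogonality, coordinate `i` of `Φ` takes the value `v` at some base point coming from
    -- `Y`. The image of that point under `Φ` is `q`, which idempotence makes a fixed point.
    Φ-fixes-some : ∀ i v → ∃[ q ] (∀ j → q j ≢ nothing) × q i ≡ just v × Φ q i ≡ just v
    Φ-fixes-some i v = q , (λ j → Φ-base j _ λ ()) , qᵢ , trans (Φ-idem _ i) qᵢ
      where
      base⇒ : ∀ j → Hom Y (G j ◁)
      base⇒ j = mkHom (λ y → Φ (λ k → just (map (Y⇒G k) y)) j)
                      (λ a → Φ-arc (λ k → base (map-arc (Y⇒G k) a)) j)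

      h : Hom Y (G i)
      h = uncone (base⇒ i) (λ y → Φ-base i _ λ ())

      hits : ∃[ y ] (∀ {z} → z ≡ y → map h z ≡ v)
      hits = orthogonal i h v

      q : Point
      q j = map (base⇒ j) (proj₁ hits)

      qᵢ : q i ≡ just v
      qᵢ = trans (sym (just-unjust _ (Φ-base i _ λ ()))) (cong just (proj₂ hits refl))

    -- Apexes are joined both ways to all base vertices, so the points from `Φ-fixes-some` serve as
    -- neighbours.
    Φ-fixes-apexes : ∀ i u → Φ (update (λ _ → nothing) i (just u)) i ≡ just u
    Φ-fixes-apexes i u = Φ-dominated i _ (update-at (λ _ → nothing) i (just u)) λ s u⟶v →
      let (q , q≢ , qᵢ , Φqᵢ) = Φ-fixes-some i _ in
      q ,
      update-elim (λ j m → Step (G j ◁) s m (q j))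
        (subst (Step (G i ◁) s (just u)) (sym qᵢ) (cone-step s u⟶v))
        (λ j _ → subst (Step (G j ◁) s nothing) (just-unjust (q j) (q≢ j)) (leaveApex s)) ,
      Φqᵢ

    -- The neighbours used have `v` at `i` and apexes elsewhere.
    Φ-fixes-base : ∀ (y : ∀ j → V (G j)) i → Φ (λ j → just (y j)) i ≡ just (y i)
    Φ-fixes-base y i = Φ-dominated i _ refl λ s yᵢ⟶v →
      update (λ _ → nothing) i (just _) ,
      update-elim (λ j → Step (G j ◁) s (just (y j))) (cone-step s yᵢ⟶v) (λ _ _ → enterApex s) ,
      Φ-fixes-apexes i _

    -- Outside `i` each coordinate is `c j` or the apex, and `nb j s` is a neighbour of both, so
    -- base points serve as neighbours. An arbitrary base vertex could be a source or a sink.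
    Φ-fixes-complement : ∀ p i u → Φ (update (complement c p) i (just u)) i ≡ just u
    Φ-fixes-complement p i u = Φ-dominated i _ (update-at (complement c p) i (just u)) λ s {v} u⟶v →
      let y = update (λ j → nb j s) i v in
      (λ j → just (y j)) ,
      update-elim₂ (λ j m w → Step (G j ◁) s m (just w))
        (cone-step s u⟶v) (λ j _ → complement⟶nb s (p j)) ,
      trans (Φ-fixes-base y i) (cong just (update-at (λ j → nb j s) i v))
      where
      complement⟶nb : ∀ s {j} m → Step (G j ◁) s (opposite {G j} (c j) m) (just (nb j s))
      complement⟶nb s {j} nothing  = cone-step s (c-nb j s)
      complement⟶nb s     (just _) = leaveApex s

    Φ-fixes : ∀ p i → Φ p i ≡ p i
    Φ-fixes p i with p i in pᵢ
    ... | nothing = Φ-apex i p pᵢ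
    -- Outside `i`, each coordinate forms a digon with its opposite, so one choice serves both
    -- directions.
    ... | just u  = Φ-dominated i p pᵢ λ s {v} u⟶v →
      update (complement c p) i (just v) ,
      update-elim (λ j → Step (G j ◁) s (p j))
        (subst (λ m → Step (G i ◁) s m (just v)) (sym pᵢ) (cone-step s u⟶v))
        (λ j _ → opposite-step (c j) (p j) s) ,
      Φ-fixes-complement p i v

-- Products over lists in coordinates.

∏-proj : ∀ 𝒢 i → Hom (∏ 𝒢) (lookup 𝒢 i)
∏-proj (G ∷ 𝒢) zero    = ⊗-proj₁ {G} {∏ 𝒢}
∏-proj (G ∷ 𝒢) (suc i) = ∏-proj 𝒢 i ⊙ ⊗-proj₂ {G} {∏ 𝒢}

∏-removeAt-proj : ∀ 𝒢 i j → j ≢ i → Hom (∏ (removeAt 𝒢 i)) (lookup 𝒢 j)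
∏-removeAt-proj (G ∷ 𝒢) zero    zero    j≢i = contradiction refl j≢i
∏-removeAt-proj (G ∷ 𝒢) zero    (suc j) _   = ∏-proj 𝒢 j
∏-removeAt-proj (G ∷ 𝒢) (suc i) zero    _   = ⊗-proj₁ {G} {∏ (removeAt 𝒢 i)}
∏-removeAt-proj (G ∷ 𝒢) (suc i) (suc j) j≢i =
  ∏-removeAt-proj 𝒢 i j (j≢i ∘ cong suc) ⊙ ⊗-proj₂ {G} {∏ (removeAt 𝒢 i)}

∏◁ : List Digraph → Digraph
∏◁ 𝒢 = ∏ (List.map _◁ 𝒢)

∏◁-proj : ∀ 𝒢 i → Hom (∏◁ 𝒢) (lookup 𝒢 i ◁)
∏◁-proj (G ∷ 𝒢) zero    = ⊗-proj₁ {G ◁} {∏◁ 𝒢}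
∏◁-proj (G ∷ 𝒢) (suc i) = ∏◁-proj 𝒢 i ⊙ ⊗-proj₂ {G ◁} {∏◁ 𝒢}

tuple : ∀ 𝒢 → (∀ i → V (lookup 𝒢 i ◁)) → V (∏◁ 𝒢)
tuple []      p = tt
tuple (G ∷ 𝒢) p = p zero , tuple 𝒢 (p ∘ suc)

tuple-arc : ∀ 𝒢 {p q} → (∀ i → ConeArc (lookup 𝒢 i) (p i) (q i)) →
            _⟶_ (∏◁ 𝒢) (tuple 𝒢 p) (tuple 𝒢 q)
tuple-arc []      a = tt
tuple-arc (G ∷ 𝒢) a = a zero , tuple-arc 𝒢 (a ∘ suc)

tuple-∏◁-proj : ∀ 𝒢 x → tuple 𝒢 (λ i → map (∏◁-proj 𝒢 i) x) ≡ x
tuple-∏◁-proj []      tt      = refl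
tuple-∏◁-proj (G ∷ 𝒢) (m , x) = cong (m ,_) (tuple-∏◁-proj 𝒢 x)

∏◁-ext : ∀ 𝒢 {x y} → (∀ i → map (∏◁-proj 𝒢 i) x ≡ map (∏◁-proj 𝒢 i) y) → x ≡ y
∏◁-ext []      _  = refl
∏◁-ext (G ∷ 𝒢) eq = cong₂ _,_ (eq zero) (∏◁-ext 𝒢 (eq ∘ suc))

allPairs-lookup : ∀ {a r} {A : Set a} {R : Rel A r} → Symmetric R → ∀ {xs} → AllPairs R xs →
                  ∀ i j → j ≢ i → R (lookup xs i) (lookup xs j)
allPairs-lookup R-sym (px ∷ pxs) zero    zero    j≢i = contradiction refl j≢i
allPairs-lookup R-sym (px ∷ pxs) zero    (suc j) _   = All.lookup px (∈-lookup j)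
allPairs-lookup R-sym (px ∷ pxs) (suc i) zero    _   = R-sym (All.lookup px (∈-lookup i))
allPairs-lookup R-sym (px ∷ pxs) (suc i) (suc j) j≢i =
  allPairs-lookup R-sym pxs i j (j≢i ∘ cong suc)

theorem37 : (𝒢 : List Digraph) →
    All IsOriented 𝒢 →
    AllPairs Incomparable 𝒢 →
    All IsCore 𝒢 →
    ((i : Fin (length 𝒢)) → ¬ Hom (∏ (removeAt 𝒢 i)) (lookup 𝒢 i) × Hom (∏ (removeAt 𝒢 i)) (lookup 𝒢 i ◁)) →
    ((i : Fin (length 𝒢)) (φ : Hom (∏ 𝒢) (lookup 𝒢 i)) → Surjective _≡_ _≡_ (map φ)) →
    IsCore (∏ (List.map _◁ 𝒢))
theorem37 [] _ _ _ _ _ _ _ _ = refl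
-- For a single graph (a) fails: the empty product is a loop, and G ◁ has none.
theorem37 (G ∷ []) (or All.∷ _) _ _ hom _ _ _ _ =
  contradiction (map-arc (proj₂ (hom zero)) tt) cone-loopless
  where
  cone-loopless : ∀ {m} → ¬ ConeArc G m m
  cone-loopless (base a) = IsOriented.loopless or refl a
theorem37 𝒢@(_ ∷ _ ∷ _) oriented incomparable core hom orthogonal φ φ-idem x =
  ∏◁-ext 𝒢 λ i → trans
    (cong (map (∏◁-proj 𝒢 i) ∘ map φ) (sym (tuple-∏◁-proj 𝒢 x)))
    (Φ-fixes Φ Φ-arc Φ-idem (λ j → map (∏◁-proj 𝒢 j) x) i)
  where
  has-through : ∀ i → ∃ (Through (lookup 𝒢 i))
  has-through i = incomparable⇒through
    -- With at least two graphs, `punchIn i zero` is an index other than `i`.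
    (allPairs-lookup swap incomparable i (punchIn i zero) (punchInᵢ≢i i zero))

  open ConeProduct (lookup 𝒢)
    (λ i → All.lookup oriented (∈-lookup i))
    (λ i → All.lookup core (∈-lookup i))
    (proj₁ ∘ has-through) (proj₁ ∘ proj₂ ∘ has-through) (λ i → proj₂ (proj₂ (has-through i)))
    (∏ ∘ removeAt 𝒢) (∏-removeAt-proj 𝒢) (proj₁ ∘ hom) (proj₂ ∘ hom)
    (∏ 𝒢) (∏-proj 𝒢) orthogonal

  Φ : Point → Point
  Φ p i = map (∏◁-proj 𝒢 i) (map φ (tuple 𝒢 p))

  Φ-arc : ∀ {p q} → StepP false p q → StepP false (Φ p) (Φ q)
  Φ-arc p⟶q i = map-arc (∏◁-proj 𝒢 i) (map-arc φ (tuple-arc 𝒢 p⟶q))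

  Φ-idem : ∀ p i → Φ (Φ p) i ≡ Φ p i
  Φ-idem p i = cong (map (∏◁-proj 𝒢 i))
    (trans (cong (map φ) (tuple-∏◁-proj 𝒢 _)) (φ-idem (tuple 𝒢 p)))
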